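{- Fix an integer $k\ge 2$ (the alphabet size). Say that $[a,b]_n$ is realizable over the $k$-letter alphabet if there is a marking of the $n$-dimensional $k$-ary hypercube in which every vertex is marked exactly $a$ times or exactly $b$ times. Then: (a) if $[a,b]_n$ is realizable, then $[a+1,b+1]_{n+k}$ is realizable; (b) if $[a,b]_n$ is realizable, then $[\ell a,\ell b]_{\ell n}$ is realizable for every positive integer $\ell$.
   Context: The $n$-dimensional $k$-ary hypercube has vertex set $\{0,1,\dots,k-1\}^n$. Its "edges" (lines) are the $nk^{n-1}$ sets of $k$ vertices obtained by fixing all coordinates except one coordinate $i$ and letting coordinate $i$ range over all $k$ values. A marking chooses, for each line, one vertex of that line; the number of times a vertex is marked is the number of lines for which it is the chosen vertex. (For $k=2$ this is an orientation of the $n$-cube, marking the head of each edge, and the mark count is the in-degree.) -}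

module Defs where

open import Data.Fin.Base using (Fin)
open import Data.Nat.Base using (ℕ; suc)
open import Data.Product.Base using (∃; proj₁)
open import Data.Sum.Base using (_⊎_)
open import Data.Vec.Base using (Vec; insertAt)
open import Function.Bundles using (_↔_)
open import Relation.Binary.PropositionalEquality using (_≡_)

Vertex : ℕ → ℕ → Set
Vertex k n = Vec (Fin k) n

-- `line i w` is the line in direction i whose remaining coordinates, in order,
-- are w.  For k ≥ 2 distinct terms of this type denote distinct sets of
-- vertices; a 0-dimensional hypercube has no lines.
data Line (k : ℕ) : ℕ → Set where
  line : ∀ {m} → Fin (suc m) → Vec (Fin k) m → Line k (suc m)

point : ∀ {k n} → Line k n → Fin k → Vertex k n
point (line i w) x = insertAt w i x

_∈ˡ_ : ∀ {k n} → Vertex k n → Line k n → Set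
v ∈ˡ l = ∃ λ x → v ≡ point l x

Marking : ℕ → ℕ → Set
Marking k n = (l : Line k n) → ∃ λ v → v ∈ˡ l

marked : ∀ {k n} → Marking k n → Line k n → Vertex k n
marked μ l = proj₁ (μ l)

-- Equality of vertices is decidable, hence proof-irrelevant, so the type on the
-- right has exactly one element for each line at which v is the marked vertex.
MarkedTimes : ∀ {k n} → Marking k n → Vertex k n → ℕ → Set
MarkedTimes {k} {n} μ v c = Fin c ↔ (∃ λ (l : Line k n) → marked μ l ≡ v)

-- `Realizable k a b n` is "[a,b]ₙ is realizable over the k-letter alphabet".
Realizable : ℕ → ℕ → ℕ → ℕ → Set
Realizable k a b n =
  ∃ λ (μ : Marking k n) → ∀ v → MarkedTimes μ v a ⊎ MarkedTimes μ v b

{-# OPTIONS --safe #-}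

-- Merge each of the n coordinates of the smaller cube with the ℓ coordinates
-- of a block by means of a quasigroup operation on the alphabet.  The resulting
-- map of the ℓn-cube onto the n-cube is a bijection on every line, so a marking
-- pulls back along it, and each mark at the image of a vertex becomes ℓ marks at
-- that vertex.  For (a), marking on every line of direction i the vertex whose
-- coordinates combine to i marks each vertex of the k-cube exactly once; take
-- the product of this marking with the given one.
module Submission where

open import Axiom.UniquenessOfIdentityProofs using (module Decidable⇒UIP)
open import Data.Fin.Base using (Fin; zero; suc; toℕ; fromℕ<; punchIn)
open import Data.Fin.Properties as Fin using (toℕ-injective; toℕ-fromℕ<; toℕ<n; punchInᵢ≢i)
open import Data.Nat using (ℕ; zero; suc; _+_; _*_; _∸_; _≤_; _<_; s≤s; z≤n)
import Data.Nat.Properties as ℕ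
open import Data.Nat.Solver using (module +-*-Solver)
open import Data.Product using (_×_; _,_; ∃; proj₁; proj₂)
open import Data.Product.Function.NonDependent.Propositional using (_×-↔_)
open import Data.Product.Properties using (,-injectiveˡ; ,-injectiveʳ)
open import Data.Sum as Sum using (_⊎_; inj₁; inj₂)
open import Data.Sum.Function.Propositional using (_⊎-↔_)
open import Data.Sum.Properties using (inj₁-injective; inj₂-injective)
open import Data.Vec.Base using (Vec; lookup; tabulate)
open import Data.Vec.Properties as Vec
  using (insertAt-lookup; insertAt-punchIn; lookup∘tabulate; tabulate∘lookup; tabulate-cong)
open import Function.Base using (_∘_)
open import Function.Bundles using (_↔_; mk↔ₛ′; module Inverse)
open import Function.Properties.Inverse using (↔-refl; ↔-sym; ↔-trans)
open import Relation.Binary.PropositionalEquality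
  using (_≡_; _≢_; refl; sym; trans; cong; cong₂; subst; module ≡-Reasoning)
open import Relation.Nullary using (yes; no; contradiction; Irrelevant)
open import Defs

private
  variable
    a b k n : ℕ
    A B I J : Set

-- Subtypes cut out by proof-irrelevant predicates.

Fin-UIP : {x y : Fin k} → Irrelevant (x ≡ y)
Fin-UIP = Decidable⇒UIP.≡-irrelevant Fin._≟_

Vertex-UIP : {v w : Vertex k n} → Irrelevant (v ≡ w)
Vertex-UIP = Decidable⇒UIP.≡-irrelevant (Vec.≡-dec Fin._≟_)

∃-≡ : {P : A → Set} → (∀ {x} → Irrelevant (P x)) →
      {x y : A} {p : P x} {q : P y} → x ≡ y → (x , p) ≡ (y , q)
∃-≡ irr refl = cong (_ ,_) (irr _ _)

-- Irrelevance reduces the inverse laws to first components, and only where the predicate holds: a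
-- line is recovered from its direction only if it passes through the given vertex.
∃-↔ : {P : A → Set} {Q : B → Set} →
      (∀ {x} → Irrelevant (P x)) → (∀ {y} → Irrelevant (Q y)) →
      (f : A → B) (g : B → A) →
      (∀ x → P x → Q (f x)) → (∀ y → Q y → P (g y)) →
      (∀ y → Q y → f (g y) ≡ y) → (∀ x → P x → g (f x) ≡ x) →
      ∃ P ↔ ∃ Q
∃-↔ irrP irrQ f g P⇒Q Q⇒P fg gf = mk↔ₛ′
  (λ (x , p) → f x , P⇒Q x p)
  (λ (y , q) → g y , Q⇒P y q)
  (λ (y , q) → ∃-≡ irrQ (fg y q))
  (λ (x , p) → ∃-≡ irrP (gf x p))

-- Markings as functions of a vertex and a direction.

AgreeOff : I → (v w : I → A) → Set
AgreeOff i v w = ∀ j → j ≢ i → v j ≡ w j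

-- A marking in terms of directions: `pick v i` is the i-th coordinate of the
-- marked vertex on the line through v in direction i.
record Choice (k : ℕ) (I : Set) : Set where
  field
    pick      : (I → Fin k) → I → Fin k
    pick-line : ∀ {v w} i → AgreeOff i v w → pick v i ≡ pick w i

open Choice

Hits : Choice k I → (I → Fin k) → Set
Hits c v = ∃ λ i → pick c v i ≡ v i

-- Directions form an arbitrary type, so that disjoint unions and products of coordinate sets can be
-- used directly, before any passage to `Fin`.
ChoiceRealizable : ℕ → Set → ℕ → ℕ → Set
ChoiceRealizable k I a b =
  ∃ λ (c : Choice k I) → ∀ v → (Fin a ↔ Hits c v) ⊎ (Fin b ↔ Hits c v)

-- Lines through a vertex, and translation between the two kinds of marking.

dir : Line k n → Fin n
dir (line i _) = i

lineThrough : (Fin n → Fin k) → Fin n → Line k n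
lineThrough {n = suc _} v i = line i (tabulate (v ∘ punchIn i))

dir-lineThrough : (v : Fin n → Fin k) (i : Fin n) → dir (lineThrough v i) ≡ i
dir-lineThrough {n = suc _} v i = refl

lookup-ext : {v w : Vec A n} → (∀ i → lookup v i ≡ lookup w i) → v ≡ w
lookup-ext {v = v} {w} eq =
  trans (sym (tabulate∘lookup v)) (trans (tabulate-cong eq) (tabulate∘lookup w))

AgreeOff-punchIn : {v w : Fin (suc n) → A} (i : Fin (suc n)) →
                   (∀ j → v (punchIn i j) ≡ w (punchIn i j)) → AgreeOff i v w
AgreeOff-punchIn {v = v} {w} i eq j j≢i =
  subst (λ j → v j ≡ w j) (Fin.punchIn-punchOut (j≢i ∘ sym)) (eq _)

lookup-point-dir : (l : Line k n) (x : Fin k) → lookup (point l x) (dir l) ≡ x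
lookup-point-dir (line i w) x = insertAt-lookup w i x

lineThrough-point : (l : Line k n) (x : Fin k) → lineThrough (lookup (point l x)) (dir l) ≡ l
lineThrough-point (line i w) x =
  cong (line i) (trans (tabulate-cong (insertAt-punchIn w i x)) (tabulate∘lookup w))

lineThrough-cong : {v w : Fin n → Fin k} (i : Fin n) → AgreeOff i v w →
                   lineThrough v i ≡ lineThrough w i
lineThrough-cong {n = suc _} i eq =
  cong (line i) (tabulate-cong λ j → eq _ (punchInᵢ≢i i j))

point-lineThrough-AgreeOff : (v : Fin n → Fin k) (i : Fin n) (x : Fin k) →
                             AgreeOff i (lookup (point (lineThrough v i) x)) v
point-lineThrough-AgreeOff {n = suc _} v i x = AgreeOff-punchIn i λ j →
  trans (insertAt-punchIn _ i x j) (lookup∘tabulate _ j)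

point-lineThrough : (v : Fin n → Fin k) (i : Fin n) →
                    point (lineThrough v i) (v i) ≡ tabulate v
point-lineThrough {n = suc _} v i = lookup-ext λ j → trans (at j) (sym (lookup∘tabulate v j))
  where
  at : ∀ j → lookup (point (lineThrough v i) (v i)) j ≡ v j
  at j with j Fin.≟ i
  ... | yes refl = insertAt-lookup _ i (v i)
  ... | no j≢i   = point-lineThrough-AgreeOff v i (v i) j j≢i

through-point : {v : Fin n → Fin k} (l : Line k n) {x : Fin k} → tabulate v ≡ point l x →
                lineThrough v (dir l) ≡ l × v (dir l) ≡ x
through-point {v = v} l {x} eq =
  trans (lineThrough-cong (dir l) (λ j _ → v≗ j)) (lineThrough-point l x) ,
  trans (v≗ (dir l)) (lookup-point-dir l x)
  where
  v≗ : ∀ j → v j ≡ lookup (point l x) j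
  v≗ j = trans (sym (lookup∘tabulate v j)) (cong (λ u → lookup u j) eq)

markedCoord : Marking k n → Line k n → Fin k
markedCoord μ l = proj₁ (proj₂ (μ l))

marked-point : (μ : Marking k n) (l : Line k n) → marked μ l ≡ point l (markedCoord μ l)
marked-point μ l = proj₂ (proj₂ (μ l))

-- A line marked at a vertex passes through it, hence is determined by its direction. Any compatible
-- pair is allowed, so that both translations can use the result.
marks↔hits : (μ : Marking k n) (c : Choice k (Fin n)) →
             (∀ v i → markedCoord μ (lineThrough v i) ≡ pick c v i) →
             ∀ v → (∃ λ l → marked μ l ≡ tabulate v) ↔ Hits c v
marks↔hits μ c compatible v = ∃-↔ Vertex-UIP Fin-UIP dir (lineThrough v)
  (λ l m → let through , vᵢ≡ = on l m in begin
    pick c v (dir l)                        ≡⟨ compatible v (dir l) ⟨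
    markedCoord μ (lineThrough v (dir l))   ≡⟨ cong (markedCoord μ) through ⟩
    markedCoord μ l                         ≡⟨ vᵢ≡ ⟨
    v (dir l)                               ∎)
  (λ i hit → begin
    marked μ (lineThrough v i)              ≡⟨ marked-point μ _ ⟩
    point (lineThrough v i) (markedCoord μ (lineThrough v i))
      ≡⟨ cong (point (lineThrough v i)) (trans (compatible v i) hit) ⟩
    point (lineThrough v i) (v i)           ≡⟨ point-lineThrough v i ⟩
    tabulate v                              ∎)
  (λ i _ → dir-lineThrough v i)
  (λ l m → proj₁ (on l m))
  where
  open ≡-Reasoning
  on : ∀ l → marked μ l ≡ tabulate v →
       lineThrough v (dir l) ≡ l × v (dir l) ≡ markedCoord μ l
  on l m = through-point l (trans (sym m) (marked-point μ l))

realizable⇒choiceRealizable : Realizable k a b n → ChoiceRealizable k (Fin n) a b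
realizable⇒choiceRealizable {k} {n = n} (μ , times) =
  c , λ v → Sum.map (λ t → ↔-trans t (hits v)) (λ t → ↔-trans t (hits v)) (times (tabulate v))
  where
  c : Choice k (Fin n)
  c .pick v i         = markedCoord μ (lineThrough v i)
  c .pick-line i eq   = cong (markedCoord μ) (lineThrough-cong i eq)

  hits = marks↔hits μ c (λ _ _ → refl)

choiceRealizable⇒realizable : ChoiceRealizable (suc k) (Fin n) a b → Realizable (suc k) a b n
choiceRealizable⇒realizable {k} {n} (c , times) =
  μ , λ v → Sum.map (λ t → ↔-trans t (marks v)) (λ t → ↔-trans t (marks v)) (times (lookup v))
  where
  coord : Line (suc k) n → Fin (suc k)
  -- `pick` ignores the coordinate in its own direction, so any point of the line would do; `zero`
  -- is a letter of the nonempty alphabet.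
  coord l = pick c (lookup (point l zero)) (dir l)

  μ : Marking (suc k) n
  μ l = point l (coord l) , coord l , refl

  compatible : ∀ v i → coord (lineThrough v i) ≡ pick c v i
  compatible v i rewrite dir-lineThrough v i =
    pick-line c i (point-lineThrough-AgreeOff v i zero)

  marks : ∀ v → Hits c (lookup v) ↔ (∃ λ l → marked μ l ≡ v)
  marks v = subst (λ u → Hits c (lookup v) ↔ (∃ λ l → marked μ l ≡ u)) (tabulate∘lookup v)
    (↔-sym (marks↔hits μ c compatible (lookup v)))

reindex : I ↔ J → ChoiceRealizable k I a b → ChoiceRealizable k J a b
reindex {I} {J} {k} I↔J (c , times) =
  c′ , λ v → Sum.map (λ t → ↔-trans t (hits v)) (λ t → ↔-trans t (hits v)) (times (v ∘ to))
  where
  open Inverse I↔J using (to; from; strictlyInverseˡ; strictlyInverseʳ)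

  c′ : Choice k J
  c′ .pick v j        = pick c (v ∘ to) (from j)
  c′ .pick-line j eq  = pick-line c (from j) λ i i≢ →
    eq (to i) λ toi≡j → i≢ (trans (sym (strictlyInverseʳ i)) (cong from toi≡j))

  hits : ∀ v → Hits c (v ∘ to) ↔ Hits c′ v
  hits v = ∃-↔ Fin-UIP Fin-UIP to from
    (λ i hit → trans (cong (pick c (v ∘ to)) (strictlyInverseʳ i)) hit)
    (λ j hit → trans hit (cong v (sym (strictlyInverseˡ j))))
    (λ j _ → strictlyInverseˡ j)
    (λ i _ → strictlyInverseʳ i)

-- A quasigroup on the alphabet.

-- The operation x ⊙ y = −1 − x − y on residues mod k, given by its graph, which
-- is symmetric in all three arguments.
data Balanced {k : ℕ} (x y z : Fin k) : Set where
  once  : toℕ x + toℕ y + suc (toℕ z) ≡ k → Balanced x y z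
  twice : toℕ x + toℕ y + suc (toℕ z) ≡ k + k → Balanced x y z

-- The number `toℕ x + toℕ y + 1` is positive and below 2k. Its complement to k, or to 2k once it
-- exceeds k, is therefore a letter.
balance : (x y : Fin k) → ∃ (Balanced x y)
balance {k} x y with suc (toℕ x + toℕ y) ℕ.≤? k
... | yes x+y<k = fromℕ< z<k , once (trans
        (cong (λ z → toℕ x + toℕ y + suc z) (toℕ-fromℕ< z<k))
        (trans (ℕ.+-suc _ _) (ℕ.m+[n∸m]≡n x+y<k)))
  where
  z<k : k ∸ suc (toℕ x + toℕ y) < k
  z<k = ℕ.∸-monoʳ-< {o = 0} (s≤s z≤n) x+y<k
... | no x+y≮k = fromℕ< z<k , twice (trans
        (cong (λ z → toℕ x + toℕ y + suc z) (toℕ-fromℕ< z<k))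
        (trans (ℕ.+-suc _ _) (ℕ.m+[n∸m]≡n x+y<2k)))
  where
  x+y<2k : suc (toℕ x + toℕ y) ≤ k + k
  x+y<2k = ℕ.+-mono-≤ (toℕ<n x) (ℕ.<⇒≤ (toℕ<n y))

  z<k : k + k ∸ suc (toℕ x + toℕ y) < k
  z<k = subst (k + k ∸ suc (toℕ x + toℕ y) <_) (ℕ.m+n∸m≡n k k)
    (ℕ.∸-monoʳ-< (ℕ.≰⇒> x+y≮k) x+y<2k)

-- The first equation forces `s < k`, and `suc (toℕ y)` is at most k, so the second sum stays below
-- 2k.
once-twice : (x y : Fin k) {s : ℕ} → s + suc (toℕ x) ≡ k → s + suc (toℕ y) ≢ k + k
once-twice {k} x y {s} p q = ℕ.<⇒≢ (ℕ.+-mono-<-≤ s<k (toℕ<n y)) q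
  where
  s<k : s < k
  s<k = subst (s <_) p (ℕ.m<m+n s (s≤s z≤n))

balanced-unique : {x y z z′ : Fin k} → Balanced x y z → Balanced x y z′ → z ≡ z′
balanced-unique (once p)  (once q)  =
  toℕ-injective (ℕ.suc-injective (ℕ.+-cancelˡ-≡ _ _ _ (trans p (sym q))))
balanced-unique (twice p) (twice q) =
  toℕ-injective (ℕ.suc-injective (ℕ.+-cancelˡ-≡ _ _ _ (trans p (sym q))))
balanced-unique (once p)  (twice q) = contradiction q (once-twice _ _ p)
balanced-unique (twice p) (once q)  = contradiction p (once-twice _ _ q)

balanced-swap₁₃ : {x y z : Fin k} → Balanced x y z → Balanced z y x
balanced-swap₁₃ {x = x} {y} {z} = λ where
    (once p)  → once  (trans rearrange p)
    (twice p) → twice (trans rearrange p)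
  where
  open +-*-Solver
  rearrange : toℕ z + toℕ y + suc (toℕ x) ≡ toℕ x + toℕ y + suc (toℕ z)
  rearrange = solve 3 (λ x y z → z :+ y :+ (con 1 :+ x) := x :+ y :+ (con 1 :+ z))
    refl (toℕ x) (toℕ y) (toℕ z)

balanced-swap₂₃ : {x y z : Fin k} → Balanced x y z → Balanced x z y
balanced-swap₂₃ {x = x} {y} {z} = λ where
    (once p)  → once  (trans rearrange p)
    (twice p) → twice (trans rearrange p)
  where
  open +-*-Solver
  rearrange : toℕ x + toℕ z + suc (toℕ y) ≡ toℕ x + toℕ y + suc (toℕ z)
  rearrange = solve 3 (λ x y z → x :+ z :+ (con 1 :+ y) := x :+ y :+ (con 1 :+ z))
    refl (toℕ x) (toℕ y) (toℕ z)

infixr 6 _⊙_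

_⊙_ : Fin k → Fin k → Fin k
x ⊙ y = proj₁ (balance x y)

-- By symmetry of the graph, `y` completes the pair `x`, `x ⊙ y`, and the completion is unique.
⊙-involutiveˡ : (x y : Fin k) → x ⊙ x ⊙ y ≡ y
⊙-involutiveˡ x y =
  balanced-unique (proj₂ (balance x (x ⊙ y))) (balanced-swap₂₃ (proj₂ (balance x y)))

⊙-involutiveʳ : (x y : Fin k) → (x ⊙ y) ⊙ y ≡ x
⊙-involutiveʳ x y =
  balanced-unique (proj₂ (balance (x ⊙ y) y)) (balanced-swap₁₃ (proj₂ (balance x y)))

-- Combining a block of coordinates, and the marking of the k-cube.

combined : (Fin n → Fin (suc k)) → Fin (suc k)
combined {zero}  v = zero
combined {suc n} v = v zero ⊙ combined (v ∘ suc)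

-- The i-th coordinate that makes v combine to t; the present one is ignored.
fill : (Fin n → Fin (suc k)) → Fin n → Fin (suc k) → Fin (suc k)
fill v zero    t = t ⊙ combined (v ∘ suc)
fill v (suc i) t = fill (v ∘ suc) i (v zero ⊙ t)

combined-cong : {v w : Fin n → Fin (suc k)} → (∀ i → v i ≡ w i) → combined v ≡ combined w
combined-cong {zero}  eq = refl
combined-cong {suc n} eq = cong₂ _⊙_ (eq zero) (combined-cong (eq ∘ suc))

fill-cong : {v w : Fin n → Fin (suc k)} (i : Fin n) (t : Fin (suc k)) → AgreeOff i v w →
            fill v i t ≡ fill w i t
fill-cong zero t eq = cong (t ⊙_) (combined-cong λ j → eq (suc j) λ ())
fill-cong {w = w} (suc i) t eq = trans
  (fill-cong i _ λ j j≢i → eq (suc j) (j≢i ∘ Fin.suc-injective))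
  (cong (λ x → fill (w ∘ suc) i (x ⊙ t)) (eq zero λ ()))

-- An equation x ⊙ r = t is solved for x by t ⊙ r and for r by x ⊙ t. With the converse
-- `combined-fill`, this says that `v` is the point with value `t` on its line exactly when `t` is
-- `combined v`.
fill-combined : (v : Fin n → Fin (suc k)) (i : Fin n) → fill v i (combined v) ≡ v i
fill-combined v zero    = ⊙-involutiveʳ _ _
fill-combined v (suc i) = trans
  (cong (fill (v ∘ suc) i) (⊙-involutiveˡ (v zero) _))
  (fill-combined (v ∘ suc) i)

combined-fill : (v : Fin n → Fin (suc k)) (i : Fin n) {t : Fin (suc k)} →
                fill v i t ≡ v i → t ≡ combined v
combined-fill v zero {t} eq = trans (sym (⊙-involutiveʳ t _)) (cong (_⊙ combined (v ∘ suc)) eq)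
combined-fill v (suc i) {t} eq =
  trans (sym (⊙-involutiveˡ (v zero) t)) (cong (v zero ⊙_) (combined-fill (v ∘ suc) i eq))

diagonal : Choice (suc k) (Fin (suc k))
diagonal .pick v i       = fill v i i
diagonal .pick-line i eq = fill-cong i i eq

-- Direction `i` is hit exactly when `i` is the letter `combined v`; directions and letters are the
-- same type here.
diagonal-hits : (v : Fin (suc k) → Fin (suc k)) → Fin 1 ↔ Hits diagonal v
diagonal-hits v = mk↔ₛ′
  (λ _ → combined v , fill-combined v (combined v))
  (λ _ → zero)
  (λ (i , hit) → ∃-≡ Fin-UIP (sym (combined-fill v i hit)))
  (λ where zero → refl)

-- Products of markings and pullbacks along block combination.

_⊎ᶜ_ : Choice k I → Choice k J → Choice k (I ⊎ J)
(c ⊎ᶜ d) .pick v (inj₁ i)      = pick c (v ∘ inj₁) i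
(c ⊎ᶜ d) .pick v (inj₂ j)      = pick d (v ∘ inj₂) j
(c ⊎ᶜ d) .pick-line (inj₁ i) eq = pick-line c i λ i′ i′≢i → eq (inj₁ i′) (i′≢i ∘ inj₁-injective)
(c ⊎ᶜ d) .pick-line (inj₂ j) eq = pick-line d j λ j′ j′≢j → eq (inj₂ j′) (j′≢j ∘ inj₂-injective)

⊎ᶜ-hits : (c : Choice k I) (d : Choice k J) (v : I ⊎ J → Fin k) →
          (Hits c (v ∘ inj₁) ⊎ Hits d (v ∘ inj₂)) ↔ Hits (c ⊎ᶜ d) v
⊎ᶜ-hits c d v = mk↔ₛ′
  (λ where (inj₁ (i , hit)) → inj₁ i , hit
           (inj₂ (j , hit)) → inj₂ j , hit)
  (λ where (inj₁ i , hit) → inj₁ (i , hit)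
           (inj₂ j , hit) → inj₂ (j , hit))
  (λ where (inj₁ _ , _) → refl
           (inj₂ _ , _) → refl)
  (λ where (inj₁ _) → refl
           (inj₂ _) → refl)

combineBlocks : ∀ {ℓ} → (Fin ℓ × I → Fin (suc k)) → I → Fin (suc k)
combineBlocks v j = combined λ i → v (i , j)

-- Block `j` consists of the coordinates `(i , j)`. A line in direction `(i , j)` maps bijectively
-- onto one in direction `j`, and the point over the marked one is picked.
pullback : ∀ ℓ → Choice (suc k) I → Choice (suc k) (Fin ℓ × I)
pullback ℓ c .pick v (i , j) = fill (λ i′ → v (i′ , j)) i (pick c (combineBlocks v) j)
pullback ℓ c .pick-line {v} {w} (i , j) eq = trans
  (fill-cong i _ λ i′ i′≢i → eq (i′ , j) (i′≢i ∘ ,-injectiveˡ))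
  -- Changing `v` at `(i , j)` changes its image only in coordinate `j`, which `pick c` ignores in
  -- direction `j`.
  (cong (fill (λ i′ → w (i′ , j)) i) (pick-line c j λ j′ j′≢j →
    combined-cong λ i′ → eq (i′ , j′) (j′≢j ∘ ,-injectiveʳ)))

-- For each `i`, direction `(i , j)` is hit at `v` exactly when `j` is hit at the image; this gives
-- the factor ℓ.
pullback-hits : ∀ ℓ (c : Choice (suc k) I) (v : Fin ℓ × I → Fin (suc k)) →
                (Fin ℓ × Hits c (combineBlocks v)) ↔ Hits (pullback ℓ c) v
pullback-hits ℓ c v = mk↔ₛ′
  (λ (i , j , hit) → (i , j) , trans (cong (fill _ i) hit) (fill-combined _ i))
  (λ ((i , j) , hit) → i , j , combined-fill _ i hit)
  (λ _ → ∃-≡ Fin-UIP refl)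
  (λ _ → cong (_ ,_) (∃-≡ Fin-UIP refl))

-- Mark counts of the two constructions, and the theorem.

⊎-diagonal-realizable : ChoiceRealizable (suc k) I a b →
                        ChoiceRealizable (suc k) (I ⊎ Fin (suc k)) (a + 1) (b + 1)
⊎-diagonal-realizable (c , times) =
  (c ⊎ᶜ diagonal) , λ v → Sum.map (extend v) (extend v) (times (v ∘ inj₁))
  where
  extend : ∀ v {m} → Fin m ↔ Hits c (v ∘ inj₁) → Fin (m + 1) ↔ Hits (c ⊎ᶜ diagonal) v
  extend v t = ↔-trans Fin.+↔⊎
    (↔-trans (t ⊎-↔ diagonal-hits (v ∘ inj₂)) (⊎ᶜ-hits c diagonal v))

pullback-realizable : ∀ ℓ → ChoiceRealizable (suc k) I a b →
                      ChoiceRealizable (suc k) (Fin ℓ × I) (ℓ * a) (ℓ * b)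
pullback-realizable ℓ (c , times) =
  pullback ℓ c , λ v → Sum.map (extend v) (extend v) (times (combineBlocks v))
  where
  extend : ∀ v {m} → Fin m ↔ Hits c (combineBlocks v) → Fin (ℓ * m) ↔ Hits (pullback ℓ c) v
  extend v t = ↔-trans Fin.*↔× (↔-trans (↔-refl ×-↔ t) (pullback-hits ℓ c v))

theorem5 : (k : ℕ) → 2 ≤ k →
    ((a b n : ℕ) → Realizable k a b n → Realizable k (a + 1) (b + 1) (n + k)) ×
    ((a b n ℓ : ℕ) → 1 ≤ ℓ → Realizable k a b n → Realizable k (ℓ * a) (ℓ * b) (ℓ * n))
theorem5 (suc k) _ =
  (λ a b n r → choiceRealizable⇒realizable
    (reindex (↔-sym Fin.+↔⊎) (⊎-diagonal-realizable (realizable⇒choiceRealizable r)))) ,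
  (λ a b n ℓ _ r → choiceRealizable⇒realizable
    (reindex (↔-sym Fin.*↔×) (pullback-realizable ℓ (realizable⇒choiceRealizable r))))
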